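{- Let $p \geq q$ and $n \geq 1$ be positive integers and let $B$ be a $p \times q$ matrix. Let $C$ be the $(nq+p)\times(nq+p)$ block matrix $$C=\begin{bmatrix} 0 & B & B & \cdots & B\\ B^T & 0 & 0 & \cdots & 0\\ B^T & 0 & 0 & \cdots & 0\\ \vdots & \vdots & \vdots & \ddots & \vdots\\ B^T & 0 & 0 & \cdots & 0\end{bmatrix},$$ with one block row/column of size $p$ followed by $n$ block rows/columns of size $q$ (so $B$ appears $n$ times in the first block row and $B^T$ appears $n$ times in the first block column). Let $D$ be the $(np+q)\times(np+q)$ block matrix $$D=\begin{bmatrix} 0 & B^T & B^T & \cdots & B^T\\ B & 0 & 0 & \cdots & 0\\ B & 0 & 0 & \cdots & 0\\ \vdots & \vdots & \vdots & \ddots & \vdots\\ B & 0 & 0 & \cdots & 0\end{bmatrix},$$ with one block row/column of size $q$ followed by $n$ block rows/columns of size $p$. Then $D$ and $C \oplus 0_{(n-1)(p-q)}$ are cospectral.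
   Context: For matrices $X,Y$, $X\oplus Y$ denotes the block diagonal matrix $\begin{bmatrix} X&0\\0&Y\end{bmatrix}$; $0_m$ is the $m\times m$ zero matrix, and $0$ denotes a zero matrix of appropriate size. Two square matrices are cospectral if they have the same eigenvalues with the same multiplicities (i.e. the same characteristic polynomial). -}

module Defs where

open import Algebra.Bundles using (CommutativeRing)
open import Algebra.Bundles.Raw using (RawRing)
open import Data.Bool.Base using (if_then_else_)
open import Data.Fin.Base using (Fin; zero; suc; toℕ)
open import Data.Fin.Properties using (_≟_)
open import Data.List.Base as List using (List; []; _∷_)
open import Data.Nat.Base as ℕ using (ℕ; zero; suc)
open import Data.Vec.Functional using (Vector; _++_; concat; replicate; removeAt; transpose; zipWith)
open import Level using (Level)
open import Relation.Nullary.Decidable.Core using (does)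
import Algebra.Definitions.RawSemiring as RawSemiringDefinitions

private
  variable
    a : Level
    A : Set a
    k l m n p q : ℕ

Matrix : Set a → ℕ → ℕ → Set a
Matrix A m n = Vector (Vector A n) m

fromBlocks : Matrix A m k → Matrix A m l → Matrix A n k → Matrix A n l →
             Matrix A (m ℕ.+ n) (k ℕ.+ l)
fromBlocks X Y Z W = zipWith _++_ X Y ++ zipWith _++_ Z W

-- [ X X ⋯ X ], with n copies of X
rowOfBlocks : (n : ℕ) → Matrix A p q → Matrix A p (n ℕ.* q)
rowOfBlocks n X i = concat (replicate n (X i))

-- n copies of X stacked vertically
columnOfBlocks : (n : ℕ) → Matrix A p q → Matrix A (n ℕ.* p) q
columnOfBlocks n X = concat (replicate n X)

module Determinant {c ℓ} (R : RawRing c ℓ) where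
  open RawRing R
  open RawSemiringDefinitions rawSemiring using (sum; _^_)

  -- Laplace expansion along the first row.
  det : Matrix Carrier n n → Carrier
  det {n = zero}  M = 1#
  det {n = suc n} M =
    sum λ j → (- 1#) ^ toℕ j * M zero j * det (λ i → removeAt (M (suc i)) j)

-- A polynomial is its list of coefficients, constant term first. Trailing
-- zeros are allowed, so equality is coefficientwise rather than equality of
-- lists.
module Polynomial {c ℓ} (R : RawRing c ℓ) where
  open RawRing R

  Poly : Set c
  Poly = List Carrier

  coeff : Poly → ℕ → Carrier
  coeff []      _       = 0#
  coeff (x ∷ f) zero    = x
  coeff (x ∷ f) (suc i) = coeff f i

  infix 4 _≈ₚ_
  _≈ₚ_ : Poly → Poly → Set ℓ
  f ≈ₚ g = ∀ i → coeff f i ≈ coeff g i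

  infixl 6 _+ₚ_
  _+ₚ_ : Poly → Poly → Poly
  []      +ₚ g       = g
  (x ∷ f) +ₚ []      = x ∷ f
  (x ∷ f) +ₚ (y ∷ g) = x + y ∷ f +ₚ g

  infixl 7 _*ₚ_
  _*ₚ_ : Poly → Poly → Poly
  []      *ₚ g = []
  (x ∷ f) *ₚ g = List.map (x *_) g +ₚ (0# ∷ f *ₚ g)

  constant : Carrier → Poly
  constant x = x ∷ []

  indeterminate : Poly
  indeterminate = 0# ∷ 1# ∷ []

  polyRawRing : RawRing c ℓ
  polyRawRing = record
    { Carrier = Poly
    ; _≈_     = _≈ₚ_
    ; _+_     = _+ₚ_
    ; _*_     = _*ₚ_
    ; -_      = List.map -_
    ; 0#      = []
    ; 1#      = constant 1#
    }

module _ {c ℓ} (R : CommutativeRing c ℓ) where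
  open CommutativeRing R using (Carrier; 0#; rawRing)
  open Polynomial rawRing
  open RawRing polyRawRing using () renaming (_+_ to _⊞_; -_ to ⊟_; 0# to 0ₚ)
  open Determinant polyRawRing using (det)

  zeroMatrix : (m n : ℕ) → Matrix Carrier m n
  zeroMatrix m n _ _ = 0#

  directSum : Matrix Carrier m m → Matrix Carrier n n → Matrix Carrier (m ℕ.+ n) (m ℕ.+ n)
  directSum {m = m} {n = n} X Y = fromBlocks X (zeroMatrix m n) (zeroMatrix n m) Y

  -- det (x I − M)
  charPoly : Matrix Carrier n n → Poly
  charPoly M = det λ i j → (if does (i ≟ j) then indeterminate else 0ₚ) ⊞ (⊟ constant (M i j))

  -- The sizes need not agree definitionally; over a nontrivial ring, equality
  -- of the (monic) characteristic polynomials forces them to be equal.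
  Cospectral : Matrix Carrier m m → Matrix Carrier n n → Set ℓ
  Cospectral M N = charPoly M ≈ₚ charPoly N

  matrixC : (n : ℕ) → Matrix Carrier p q → Matrix Carrier (p ℕ.+ n ℕ.* q) (p ℕ.+ n ℕ.* q)
  matrixC {p = p} {q = q} n B =
    fromBlocks (zeroMatrix p p)                 (rowOfBlocks n B)
               (columnOfBlocks n (transpose B)) (zeroMatrix (n ℕ.* q) (n ℕ.* q))

  matrixD : (n : ℕ) → Matrix Carrier p q → Matrix Carrier (q ℕ.+ n ℕ.* p) (q ℕ.+ n ℕ.* p)
  matrixD {p = p} {q = q} n B =
    fromBlocks (zeroMatrix q q)     (rowOfBlocks n (transpose B))
               (columnOfBlocks n B) (zeroMatrix (n ℕ.* p) (n ℕ.* p))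

{-# OPTIONS --safe #-}

-- Write G(U, V) for the block matrix [x I, U; V, x I], with U of size m × k.
-- Row operations reduce it to block triangular form in two ways:
--   x^m det G(U, V) = x^k det (x² I − U V)  and  x^k det G(U, V) = x^m det (x² I − V U).
-- The indeterminate x is cancellable, so by the first identity det G(U, V) depends
-- on U and V, up to a power of x, only through U V. Hence
--   det (x I − D) = x^((n−1)p) det G(−n Bᵀ, −B),  det (x I − C) = x^((n−1)q) det G(−n B, −Bᵀ),
-- and the second identity shows that the two determinants on the right agree.

module Submission where

open import Defs
open import Algebra.Bundles using (CommutativeRing)
open import Data.Bool.Base using (if_then_else_)
open import Data.Empty using (⊥-elim)
open import Data.Fin.Base as Fin using (Fin; zero; suc; toℕ; inject₁; punchIn; quotRem; _↑ˡ_; _↑ʳ_)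
open import Data.Fin.Properties using (_≟_; toℕ-inject₁; toℕ-↑ˡ; splitAt-↑ˡ; splitAt-↑ʳ; suc-injective)
open import Data.List.Base as List using ([]; _∷_)
open import Data.Nat.Base as ℕ using (ℕ; zero; suc; _≥_; _*_; _∸_; z≤n; s≤s)
open import Data.Product.Base using (_,_; proj₁)
open import Data.Unit.Base using (⊤; tt)
open import Data.Vec.Functional as Vector using (Vector; _++_; removeAt; transpose; zipWith)
open import Data.Vec.Functional.Properties using (lookup-++ˡ; lookup-++ʳ)
open import Function.Base using (_∘_)
open import Relation.Binary.PropositionalEquality as ≡ using (_≡_; _≢_)
open import Relation.Nullary.Decidable.Core using (does)
import Data.Nat.Properties as ℕ

-- `det` is defined by expansion along the first row, so the row operations are justified by
-- linearity in each row and vanishing on repeated rows, with no product formula for determinants.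
-- Vanishing comes from pairing the terms of the double expansion; antisymmetry would only give 2
-- det = 0, and 2 may be a zero divisor. Clearing a block of G(U, V) would ordinarily divide by x.
-- Instead the rows to be changed are scaled by x beforehand, which costs one factor x per row; the
-- power on the other side of each identity is the determinant of the diagonal block x I left in
-- place. Both identities thus hold for every element x of every commutative ring, and polynomials
-- are needed only to supply a cancellable x. The power of x separating the two determinants is the
-- characteristic polynomial of the added zero block.

splitFin : ∀ {a} m {k} (P : Fin (m ℕ.+ k) → Set a) →
           (∀ i → P (i ↑ˡ k)) → (∀ i → P (m ↑ʳ i)) → ∀ i → P i
splitFin zero    P l r i       = r i
splitFin (suc m) P l r zero    = l zero
splitFin (suc m) P l r (suc i) = splitFin m (P ∘ suc) (l ∘ suc) r i

↑ˡ≢↑ʳ : ∀ {m k} (i : Fin m) (j : Fin k) → i ↑ˡ k ≢ m ↑ʳ j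
↑ˡ≢↑ʳ {suc m} (suc i) j eq = ↑ˡ≢↑ʳ i j (suc-injective eq)

-- Deleting a column of a block matrix, and deleting two columns

punchIn-↑ˡ : ∀ {m} k (i : Fin (suc m)) (j : Fin m) → punchIn (i ↑ˡ k) (j ↑ˡ k) ≡ punchIn i j ↑ˡ k
punchIn-↑ˡ k zero    j       = ≡.refl
punchIn-↑ˡ k (suc i) zero    = ≡.refl
punchIn-↑ˡ k (suc i) (suc j) = ≡.cong suc (punchIn-↑ˡ k i j)

punchIn-↑ʳ : ∀ m {k} (i : Fin (suc m)) (j : Fin k) → punchIn (i ↑ˡ k) (m ↑ʳ j) ≡ suc m ↑ʳ j
punchIn-↑ʳ m       zero    j = ≡.refl
punchIn-↑ʳ (suc m) (suc i) j = ≡.cong suc (punchIn-↑ʳ m i j)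

-- Columns a < b are coded as `inject₁ j` and `suc k` with `j ≤ k`. Once a is deleted, b has index
-- `k`; once b is deleted, a still has index `j`; either order leaves the same columns.
punchIn-inject₁ : ∀ {n} (j k : Fin n) → j Fin.≤ k → punchIn (inject₁ j) k ≡ suc k
punchIn-inject₁ zero    k       _         = ≡.refl
punchIn-inject₁ (suc j) (suc k) (s≤s j≤k) = ≡.cong suc (punchIn-inject₁ j k j≤k)

punchIn-suc : ∀ {n} (j k : Fin n) → j Fin.≤ k → punchIn (suc k) j ≡ inject₁ j
punchIn-suc zero    k       _         = ≡.refl
punchIn-suc (suc j) (suc k) (s≤s j≤k) = ≡.cong suc (punchIn-suc j k j≤k)

punchIn-punchIn : ∀ {n} (j k : Fin (suc n)) (i : Fin n) → j Fin.≤ k →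
                  punchIn (inject₁ j) (punchIn k i) ≡ punchIn (suc k) (punchIn j i)
punchIn-punchIn zero    k       i       _         = ≡.refl
punchIn-punchIn (suc j) (suc k) zero    _         = ≡.refl
punchIn-punchIn (suc j) (suc k) (suc i) (s≤s j≤k) = ≡.cong suc (punchIn-punchIn j k i j≤k)

module _ {a} {A : Set a} {m n k l} (X : Matrix A m k) (Y : Matrix A m l) (Z : Matrix A n k) (W : Matrix A n l) where

  fromBlocks-↑ˡ↑ˡ : ∀ i j → fromBlocks X Y Z W (i ↑ˡ n) (j ↑ˡ l) ≡ X i j
  fromBlocks-↑ˡ↑ˡ i j = ≡.trans (≡.cong (λ r → r (j ↑ˡ l)) (lookup-++ˡ (zipWith _++_ X Y) (zipWith _++_ Z W) i)) (lookup-++ˡ (X i) (Y i) j)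

  fromBlocks-↑ˡ↑ʳ : ∀ i j → fromBlocks X Y Z W (i ↑ˡ n) (k ↑ʳ j) ≡ Y i j
  fromBlocks-↑ˡ↑ʳ i j = ≡.trans (≡.cong (λ r → r (k ↑ʳ j)) (lookup-++ˡ (zipWith _++_ X Y) (zipWith _++_ Z W) i)) (lookup-++ʳ (X i) (Y i) j)

  fromBlocks-↑ʳ↑ˡ : ∀ i j → fromBlocks X Y Z W (m ↑ʳ i) (j ↑ˡ l) ≡ Z i j
  fromBlocks-↑ʳ↑ˡ i j = ≡.trans (≡.cong (λ r → r (j ↑ˡ l)) (lookup-++ʳ (zipWith _++_ X Y) (zipWith _++_ Z W) i)) (lookup-++ˡ (Z i) (W i) j)

  fromBlocks-↑ʳ↑ʳ : ∀ i j → fromBlocks X Y Z W (m ↑ʳ i) (k ↑ʳ j) ≡ W i j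
  fromBlocks-↑ʳ↑ʳ i j = ≡.trans (≡.cong (λ r → r (k ↑ʳ j)) (lookup-++ʳ (zipWith _++_ X Y) (zipWith _++_ Z W) i)) (lookup-++ʳ (Z i) (W i) j)

-- Determinants over a commutative ring

module DeterminantProperties {c ℓ} (R : CommutativeRing c ℓ) where
  open CommutativeRing R hiding (zero; _-_) renaming (_*_ to infixl 7 _·_)
  open Determinant rawRing using (det)
  open import Algebra.Properties.Ring ring using (-‿distribˡ-*; -‿+-comm; -0#≈0#; -1*x≈-x)
  open import Algebra.Properties.Semiring.Exp semiring using (_^_; ^-homo-*; ^-congʳ)
  open import Algebra.Properties.Semiring.Mult semiring using (_×_; ×-assoc-*; ×-comm-*)
  open import Algebra.Properties.Semiring.Sum semiring using (sum; sum-cong-≋; sum-replicate-zero; ∑-distrib-+; *-distribˡ-sum)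
  open import Algebra.Solver.Ring.NaturalCoefficients.Default commutativeSemiring using (solve; _:=_; _:+_; _:*_)
  open import Relation.Binary.Reasoning.Setoid setoid

  -- The summands are explicit because they cannot be inferred once sum unfolds at size suc n.
  sum-cong : ∀ {n} (f g : Vector Carrier n) → (∀ i → f i ≈ g i) → sum f ≈ sum g
  sum-cong f g = sum-cong-≋

  sum-zero : ∀ {n} (f : Vector Carrier n) → (∀ i → f i ≈ 0#) → sum f ≈ 0#
  sum-zero {n} f f≈0 = trans (sum-cong f (λ _ → 0#) f≈0) (sum-replicate-zero n)

  sum-neg : ∀ {n} (f : Vector Carrier n) → sum (λ i → - f i) ≈ - sum f
  sum-neg {zero}  f = sym -0#≈0#
  sum-neg {suc n} f = trans (+-congˡ (sum-neg (f ∘ suc))) (-‿+-comm _ _)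

  sum-linear : ∀ {n} a b (f g : Vector Carrier n) →
               sum (λ i → a · f i + b · g i) ≈ a · sum f + b · sum g
  sum-linear a b f g = trans (∑-distrib-+ (λ i → a · f i) (λ i → b · g i))
    (+-cong (sym (*-distribˡ-sum a f)) (sym (*-distribˡ-sum b g)))

  sum-split : ∀ m {k} (f : Vector Carrier (m ℕ.+ k)) →
              sum f ≈ sum (λ i → f (i ↑ˡ k)) + sum (λ i → f (m ↑ʳ i))
  sum-split zero    f = sym (+-identityˡ _)
  sum-split (suc m) f = trans (+-congˡ (sum-split m (f ∘ suc))) (sym (+-assoc _ _ _))

  -- The pairs (j , k), with k counted among the indices other than j, come in
  -- couples (a , b), (b , a) with a < b, encoded as (inject₁ j , k), (suc k , j).
  sum-cancel : ∀ {n} (F : Fin (suc n) → Fin n → Carrier) →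
               (∀ j k → j Fin.≤ k → F (inject₁ j) k + F (suc k) j ≈ 0#) →
               sum (λ j → sum (F j)) ≈ 0#
  sum-cancel {zero}  F h = +-identityˡ 0#
  sum-cancel {suc n} F h = begin
    sum (F zero) + sum (λ j → F (suc j) zero + sum (λ k → F (suc j) (suc k)))
      ≈⟨ +-congˡ (∑-distrib-+ (λ j → F (suc j) zero) (λ j → sum (λ k → F (suc j) (suc k)))) ⟩
    sum (F zero) + (sum (λ j → F (suc j) zero) + sum (λ j → sum (λ k → F (suc j) (suc k))))
      ≈⟨ +-assoc _ _ _ ⟨
    sum (F zero) + sum (λ j → F (suc j) zero) + sum (λ j → sum (λ k → F (suc j) (suc k)))
      ≈⟨ +-cong (sym (∑-distrib-+ (F zero) (λ j → F (suc j) zero)))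
                (sum-cancel (λ j k → F (suc j) (suc k)) λ j k j≤k → h (suc j) (suc k) (s≤s j≤k)) ⟩
    sum (λ k → F zero k + F (suc k) zero) + 0#
      ≈⟨ trans (+-identityʳ _) (sum-zero (λ k → F zero k + F (suc k) zero) λ k → h zero k z≤n) ⟩
    0# ∎

  minor : ∀ {n} → Matrix Carrier (suc n) (suc n) → Fin (suc n) → Matrix Carrier n n
  minor M j i = removeAt (M (suc i)) j

  sign : ∀ {n} → Fin n → Carrier
  sign j = (- 1#) ^ toℕ j

  laplace : ∀ {n} → Matrix Carrier (suc n) (suc n) → Vector Carrier (suc n)
  laplace M j = sign j · M zero j · det (minor M j)

  det-cong : ∀ {n} {M N : Matrix Carrier n n} → (∀ i j → M i j ≈ N i j) → det M ≈ det N
  det-cong {zero}  M≈N = refl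
  det-cong {suc n} {M} {N} M≈N = sum-cong (laplace M) (laplace N) λ j →
    *-cong (*-congˡ (M≈N zero j)) (det-cong λ i k → M≈N (suc i) (punchIn j k))

  Congruent : ∀ {m n} → (Matrix Carrier m n → Carrier) → Set _
  Congruent f = ∀ {M N} → (∀ i j → M i j ≈ N i j) → f M ≈ f N

  -- Phrased for three matrices that agree entrywise off row `i`, so that neither a row-update
  -- operation nor equality of functions is involved.
  RowLinear : ∀ {m n} → (Matrix Carrier m n → Carrier) → Set _
  RowLinear f = ∀ i a b {M N P} →
    (∀ k → M i k ≈ a · N i k + b · P i k) →
    (∀ j → j ≢ i → ∀ k → M j k ≈ N j k) →
    (∀ j → j ≢ i → ∀ k → M j k ≈ P j k) →
    f M ≈ a · f N + b · f P

  det-rowLinear : ∀ {n} → RowLinear (det {n})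
  det-rowLinear {suc n} zero a b {M} {N} {P} at M≈N M≈P = trans
    (sum-cong (laplace M) (λ j → a · laplace N j + b · laplace P j) λ j → begin
      sign j · M zero j · det (minor M j)
        ≈⟨ *-congʳ (*-congˡ (at j)) ⟩
      sign j · (a · N zero j + b · P zero j) · det (minor M j)
        ≈⟨ solve 6 (λ s a b x y d → s :* (a :* x :+ b :* y) :* d := a :* (s :* x :* d) :+ b :* (s :* y :* d))
             refl (sign j) a b (N zero j) (P zero j) (det (minor M j)) ⟩
      a · (sign j · N zero j · det (minor M j)) + b · (sign j · P zero j · det (minor M j))
        ≈⟨ +-cong (*-congˡ (*-congˡ (det-cong λ i k → M≈N (suc i) (λ ()) (punchIn j k))))
                  (*-congˡ (*-congˡ (det-cong λ i k → M≈P (suc i) (λ ()) (punchIn j k)))) ⟩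
      a · (sign j · N zero j · det (minor N j)) + b · (sign j · P zero j · det (minor P j)) ∎)
    (sum-linear a b (laplace N) (laplace P))
  det-rowLinear {suc n} (suc i) a b {M} {N} {P} at M≈N M≈P = trans
    (sum-cong (laplace M) (λ j → a · laplace N j + b · laplace P j) λ j → begin
      sign j · M zero j · det (minor M j)
        ≈⟨ *-congˡ (det-rowLinear i a b (λ k → at (punchIn j k))
             (λ l l≢i k → M≈N (suc l) (l≢i ∘ suc-injective) (punchIn j k))
             (λ l l≢i k → M≈P (suc l) (l≢i ∘ suc-injective) (punchIn j k))) ⟩
      sign j · M zero j · (a · det (minor N j) + b · det (minor P j))
        ≈⟨ solve 6 (λ s x a b d e → s :* x :* (a :* d :+ b :* e) := a :* (s :* x :* d) :+ b :* (s :* x :* e))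
             refl (sign j) (M zero j) a b (det (minor N j)) (det (minor P j)) ⟩
      a · (sign j · M zero j · det (minor N j)) + b · (sign j · M zero j · det (minor P j))
        ≈⟨ +-cong (*-congˡ (*-congʳ (*-congˡ (M≈N zero (λ ()) j))))
                  (*-congˡ (*-congʳ (*-congˡ (M≈P zero (λ ()) j)))) ⟩
      a · (sign j · N zero j · det (minor N j)) + b · (sign j · P zero j · det (minor P j)) ∎)
    (sum-linear a b (laplace N) (laplace P))

  -- Repeated rows and row exchange

  module _ {n} (M : Matrix Carrier (suc (suc n)) (suc (suc n))) where

    private
      D : Fin (suc (suc n)) → Fin (suc n) → Carrier
      D j k = det (minor (minor M j) k)

      D-sym : ∀ j k → j Fin.≤ k → D (inject₁ j) k ≈ D (suc k) j
      D-sym j k j≤k = det-cong λ i l → reflexive (≡.cong (M (suc (suc i))) (punchIn-punchIn j k l j≤k))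

      term : (u v : Vector Carrier (suc (suc n))) → Fin (suc (suc n)) → Fin (suc n) → Carrier
      term u v j k = sign j · u j · (sign k · v (punchIn j k) · D j k)

      -- Both terms hold the same two entries and the same second minor. Their signs are (-1)^(j+k)
      -- and (-1)^(k+1+j): deleting a shifts b one place to the left, while deleting b does not move
      -- a.
      term-cancel : ∀ u v j k → j Fin.≤ k → term u v (inject₁ j) k + term v u (suc k) j ≈ 0#
      term-cancel u v j k j≤k = begin
        term u v (inject₁ j) k + term v u (suc k) j
          ≈⟨ +-cong (*-cong (*-congʳ (reflexive (≡.cong ((- 1#) ^_) (toℕ-inject₁ j))))
                            (*-cong (*-congˡ (reflexive (≡.cong v (punchIn-inject₁ j k j≤k)))) (D-sym j k j≤k)))
                    (*-congˡ (*-congʳ (*-congˡ (reflexive (≡.cong u (punchIn-suc j k j≤k)))))) ⟩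
        sign j · u (inject₁ j) · (sign k · v (suc k) · d) + (- 1# · sign k) · v (suc k) · (sign j · u (inject₁ j) · d)
          ≈⟨ solve 6 (λ s t e x y d →
               s :* x :* (t :* y :* d) :+ (e :* t) :* y :* (s :* x :* d) :=
               s :* x :* (t :* y :* d) :+ e :* (s :* x :* (t :* y :* d)))
               refl (sign j) (sign k) (- 1#) (u (inject₁ j)) (v (suc k)) d ⟩
        w + - 1# · w  ≈⟨ +-congˡ (-1*x≈-x w) ⟩
        w + - w       ≈⟨ -‿inverseʳ w ⟩
        0#            ∎
        where
        d = D (suc k) j
        w = sign j · u (inject₁ j) · (sign k · v (suc k) · d)

      expand₂ : Vector Carrier (suc (suc n)) → Vector Carrier (suc (suc n)) → Carrier
      expand₂ u v = sum λ j → sum (term u v j)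

      rows₀₁ : Vector Carrier (suc (suc n)) → Vector Carrier (suc (suc n)) → Matrix Carrier (suc (suc n)) (suc (suc n))
      rows₀₁ u v = u Vector.∷ v Vector.∷ (λ i → M (suc (suc i)))

      det-expand₂ : ∀ u v → det (rows₀₁ u v) ≈ expand₂ u v
      det-expand₂ u v = sum-cong (laplace (rows₀₁ u v)) (λ j → sum (term u v j)) λ j → *-distribˡ-sum (sign j · u j) (λ k → sign k · v (punchIn j k) · D j k)

      det-rows₀₁ : det M ≈ expand₂ (M zero) (M (suc zero))
      det-rows₀₁ = sum-cong (laplace M) (λ j → sum (term (M zero) (M (suc zero)) j)) λ j → *-distribˡ-sum (sign j · M zero j) (λ k → sign k · M (suc zero) (punchIn j k) · D j k)

    swap₀₁ : Matrix Carrier (suc (suc n)) (suc (suc n))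
    swap₀₁ = rows₀₁ (M (suc zero)) (M zero)

    -- With row zero replaced by its equal, the terms (a, b) and (b, a) of a single double expansion
    -- cancel.
    det-equal₀₁ : (∀ k → M zero k ≈ M (suc zero) k) → det M ≈ 0#
    det-equal₀₁ eq = begin
      det M                            ≈⟨ det-rows₀₁ ⟩
      expand₂ (M zero) (M (suc zero))  ≈⟨ sum-cong (λ j → sum (term (M zero) (M (suc zero)) j)) (λ j → sum (term (M (suc zero)) (M (suc zero)) j))
                                            (λ j → sum-cong (term (M zero) (M (suc zero)) j) (term (M (suc zero)) (M (suc zero)) j)
                                              λ k → *-congʳ (*-congˡ (eq j))) ⟩
      expand₂ (M (suc zero)) (M (suc zero)) ≈⟨ sum-cancel (term (M (suc zero)) (M (suc zero))) (term-cancel (M (suc zero)) (M (suc zero))) ⟩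
      0#                               ∎

    -- The term (a, b) of one expansion cancels the term (b, a) of the other, so the two expansions
    -- are added before pairing.
    det-swap₀₁ : det M + det swap₀₁ ≈ 0#
    det-swap₀₁ = begin
      det M + det swap₀₁
        ≈⟨ +-cong det-rows₀₁ (det-expand₂ v u) ⟩
      expand₂ u v + expand₂ v u
        ≈⟨ ∑-distrib-+ (λ j → sum (term u v j)) (λ j → sum (term v u j)) ⟨
      sum (λ j → sum (term u v j) + sum (term v u j))
        ≈⟨ sum-cong (λ j → sum (term u v j) + sum (term v u j)) (λ j → sum (λ k → term u v j k + term v u j k)) (λ j → sym (∑-distrib-+ (term u v j) (term v u j))) ⟩
      sum (λ j → sum (λ k → term u v j k + term v u j k))
        ≈⟨ sum-cancel (λ j k → term u v j k + term v u j k) (λ j k j≤k → begin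
             term u v (inject₁ j) k + term v u (inject₁ j) k + (term u v (suc k) j + term v u (suc k) j)
               ≈⟨ solve 4 (λ a b c d → a :+ b :+ (c :+ d) := (a :+ d) :+ (b :+ c)) refl
                    (term u v (inject₁ j) k) (term v u (inject₁ j) k) (term u v (suc k) j) (term v u (suc k) j) ⟩
             term u v (inject₁ j) k + term v u (suc k) j + (term v u (inject₁ j) k + term u v (suc k) j)
               ≈⟨ +-cong (term-cancel u v j k j≤k) (term-cancel v u j k j≤k) ⟩
             0# + 0#
               ≈⟨ +-identityˡ 0# ⟩
             0# ∎) ⟩
      0# ∎
      where
      u = M zero
      v = M (suc zero)

  mutual
    det-alternating : ∀ {n} (M : Matrix Carrier n n) {i j} → i ≢ j → (∀ k → M i k ≈ M j k) → det M ≈ 0#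
    det-alternating M {zero}  {zero}  i≢j eq = ⊥-elim (i≢j ≡.refl)
    det-alternating M {zero}  {suc j} i≢j eq = det-equal-head M j eq
    det-alternating M {suc i} {zero}  i≢j eq = det-equal-head M i (sym ∘ eq)
    det-alternating M {suc i} {suc j} i≢j eq = sum-zero (laplace M) λ k →
      trans (*-congˡ (det-alternating (minor M k) (i≢j ∘ ≡.cong suc) (eq ∘ punchIn k))) (zeroʳ _)

    -- Exchanging rows zero and one moves the repeated row below the first, where every minor of the
    -- first row contains both copies and induction on the size applies.
    det-equal-head : ∀ {n} (M : Matrix Carrier (suc n) (suc n)) j → (∀ k → M zero k ≈ M (suc j) k) → det M ≈ 0#
    det-equal-head M zero    eq = det-equal₀₁ M eq
    det-equal-head M (suc j) eq = begin
      det M                   ≈⟨ +-identityʳ _ ⟨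
      det M + 0#              ≈⟨ +-congˡ (sum-zero (laplace (swap₀₁ M)) λ k → trans (*-congˡ (det-alternating (minor (swap₀₁ M) k) {zero} {suc j} (λ ()) (eq ∘ punchIn k))) (zeroʳ _)) ⟨
      det M + det (swap₀₁ M)  ≈⟨ det-swap₀₁ M ⟩
      0#                      ∎

  -- Row operations between the two halves of a matrix

  linear-vanishes : ∀ {n l} (g : Vector Carrier n → Carrier) →
    (∀ a b {u v w} → (∀ k → u k ≈ a · v k + b · w k) → g u ≈ a · g v + b · g w) →
    (w : Matrix Carrier l n) → (∀ j → g (w j) ≈ 0#) →
    (c : Vector Carrier l) → g (λ k → sum λ j → c j · w j k) ≈ 0#
  linear-vanishes {l = zero} g lin w g≈0 c = begin
    -- The empty combination is the zero vector, read as 0 · 0 + 0 · 0 to fit the two-term form of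
    -- linearity.
    g (λ _ → 0#)                                ≈⟨ lin 0# 0# (λ k → sym (trans (+-cong (zeroˡ 0#) (zeroˡ 0#)) (+-identityˡ 0#))) ⟩
    0# · g (λ _ → 0#) + 0# · g (λ _ → 0#)       ≈⟨ +-cong (zeroˡ _) (zeroˡ _) ⟩
    0# + 0#                                     ≈⟨ +-identityˡ 0# ⟩
    0#                                          ∎
  linear-vanishes {l = suc l} g lin w g≈0 c = begin
    g (λ k → sum λ j → c j · w j k)                    ≈⟨ lin (c zero) 1# (λ k → +-congˡ (sym (*-identityˡ _))) ⟩
    c zero · g (w zero) + 1# · g (λ k → sum λ j → c (suc j) · w (suc j) k)
      ≈⟨ +-cong (*-congˡ (g≈0 zero)) (*-congˡ (linear-vanishes g lin (w ∘ suc) (g≈0 ∘ suc) (c ∘ suc))) ⟩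
    c zero · 0# + 1# · 0#                              ≈⟨ +-cong (zeroʳ _) (zeroʳ _) ⟩
    0# + 0#                                            ≈⟨ +-identityˡ 0# ⟩
    0#                                                 ∎

  -- Induction on the number of rows: with its first row fixed, `f` satisfies the same hypotheses in
  -- the remaining rows. This is why `f` is an arbitrary row-linear function; the same generality
  -- serves both the top and the bottom half of a determinant.
  scale-and-add-rows : ∀ {m n l} (f : Matrix Carrier m n → Carrier) → Congruent f → RowLinear f →
    (w : Matrix Carrier l n) → (∀ M i j → (∀ k → M i k ≈ w j k) → f M ≈ 0#) →
    ∀ x (c : Matrix Carrier m l) M →
    f (λ i k → x · M i k + sum (λ j → c i j · w j k)) ≈ x ^ m · f M
  scale-and-add-rows {zero}  f f-cong f-lin w f≈0 x c M = trans (f-cong (λ ())) (sym (*-identityˡ _))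
  scale-and-add-rows {suc m} f f-cong f-lin w f≈0 x c M = begin
    f N                                             ≈⟨ f-lin zero x 1# (λ k → +-congˡ (sym (*-identityˡ _))) off off ⟩
    x · f (M zero Vector.∷ rest) + 1# · f ((λ k → sum λ j → c zero j · w j k) Vector.∷ rest)
      ≈⟨ +-cong (*-congˡ (scale-and-add-rows (λ T → f (M zero Vector.∷ T)) f-cong′ f-lin′ w
                            (λ T i j eq → f≈0 (M zero Vector.∷ T) (suc i) j eq) x (c ∘ suc) (M ∘ suc)))
                -- Row zero is here a combination of the rows of `w`, and each `w j` in that place
                -- makes `f` vanish.
                (*-congˡ (linear-vanishes (λ r → f (r Vector.∷ rest)) head-lin w
                            (λ j → f≈0 (w j Vector.∷ rest) zero j (λ _ → refl)) (c zero))) ⟩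
    x · (x ^ m · f (M zero Vector.∷ (M ∘ suc))) + 1# · 0#   ≈⟨ trans (+-congˡ (zeroʳ 1#)) (+-identityʳ _) ⟩
    x · (x ^ m · f (M zero Vector.∷ (M ∘ suc)))             ≈⟨ *-assoc _ _ _ ⟨
    x ^ suc m · f (M zero Vector.∷ (M ∘ suc))               ≈⟨ *-congˡ (f-cong λ { zero k → refl ; (suc i) k → refl }) ⟩
    x ^ suc m · f M                                         ∎
    where
    N : Matrix Carrier (suc m) _
    N i k = x · M i k + sum (λ j → c i j · w j k)
    rest : Matrix Carrier m _
    rest = N ∘ suc
    off : ∀ {r} i → i ≢ zero → ∀ k → N i k ≈ (r Vector.∷ rest) i k
    off zero    i≢0 k = ⊥-elim (i≢0 ≡.refl)
    off (suc i) i≢0 k = refl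
    f-cong′ : Congruent (λ T → f (M zero Vector.∷ T))
    f-cong′ eq = f-cong λ { zero k → refl ; (suc i) k → eq i k }
    f-lin′ : RowLinear (λ T → f (M zero Vector.∷ T))
    f-lin′ i a b at off₁ off₂ = f-lin (suc i) a b at
      (λ { zero _ k → refl ; (suc j) j≢i k → off₁ j (j≢i ∘ ≡.cong suc) k })
      (λ { zero _ k → refl ; (suc j) j≢i k → off₂ j (j≢i ∘ ≡.cong suc) k })
    head-lin : ∀ a b {u v w} → (∀ k → u k ≈ a · v k + b · w k) →
               f (u Vector.∷ rest) ≈ a · f (v Vector.∷ rest) + b · f (w Vector.∷ rest)
    head-lin a b eq = f-lin zero a b eq
      (λ { zero i≢0 k → ⊥-elim (i≢0 ≡.refl) ; (suc i) _ k → refl })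
      (λ { zero i≢0 k → ⊥-elim (i≢0 ≡.refl) ; (suc i) _ k → refl })

  lookupˡ : ∀ {m k n} (T : Matrix Carrier m n) (B : Matrix Carrier k n) i j → (T ++ B) (i ↑ˡ k) j ≈ T i j
  lookupˡ T B i j = reflexive (≡.cong (λ r → r j) (lookup-++ˡ T B i))

  lookupʳ : ∀ {m k n} (T : Matrix Carrier m n) (B : Matrix Carrier k n) i j → (T ++ B) (m ↑ʳ i) j ≈ B i j
  lookupʳ T B i j = reflexive (≡.cong (λ r → r j) (lookup-++ʳ T B i))

  -- The predicate `P` selects the rows to compare: all of them for congruence, all but one for
  -- linearity in a row.
  ++-cong-on : ∀ {p m k n} (P : Fin (m ℕ.+ k) → Set p) {T U : Matrix Carrier m n} {B C : Matrix Carrier k n} →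
    (∀ i → P (i ↑ˡ k) → ∀ j → T i j ≈ U i j) → (∀ i → P (m ↑ʳ i) → ∀ j → B i j ≈ C i j) →
    ∀ i → P i → ∀ j → (T ++ B) i j ≈ (U ++ C) i j
  ++-cong-on {m = m} P {T} {U} {B} {C} T≈U B≈C = splitFin m (λ i → P i → ∀ j → (T ++ B) i j ≈ (U ++ C) i j)
    (λ i p j → trans (lookupˡ T B i j) (trans (T≈U i p j) (sym (lookupˡ U C i j))))
    (λ i p j → trans (lookupʳ T B i j) (trans (B≈C i p j) (sym (lookupʳ U C i j))))

  module _ {m k n} (f : Matrix Carrier (m ℕ.+ k) n → Carrier) where

    module _ (f-cong : Congruent f) where

      ++-congruentˡ : ∀ B → Congruent (λ (T : Matrix Carrier m n) → f (T ++ B))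
      ++-congruentˡ B eq = f-cong λ i → ++-cong-on (λ _ → ⊤) (λ i _ → eq i) (λ _ _ _ → refl) i tt

      ++-congruentʳ : ∀ T → Congruent (λ (B : Matrix Carrier k n) → f (T ++ B))
      ++-congruentʳ T eq = f-cong λ i → ++-cong-on (λ _ → ⊤) (λ _ _ _ → refl) (λ i _ → eq i) i tt

    module _ (f-lin : RowLinear f) where

      ++-rowLinearˡ : ∀ B → RowLinear (λ (T : Matrix Carrier m n) → f (T ++ B))
      ++-rowLinearˡ B i a b {M} {N} {P} at off₁ off₂ = f-lin (i ↑ˡ k) a b
        (λ j → trans (lookupˡ M B i j) (trans (at j)
          (sym (+-cong (*-congˡ (lookupˡ N B i j)) (*-congˡ (lookupˡ P B i j))))))
        (++-cong-on (_≢ i ↑ˡ k) (λ j j≢i → off₁ j (j≢i ∘ ≡.cong (_↑ˡ k))) (λ _ _ _ → refl))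
        (++-cong-on (_≢ i ↑ˡ k) (λ j j≢i → off₂ j (j≢i ∘ ≡.cong (_↑ˡ k))) (λ _ _ _ → refl))

      ++-rowLinearʳ : ∀ T → RowLinear (λ (B : Matrix Carrier k n) → f (T ++ B))
      ++-rowLinearʳ T i a b {M} {N} {P} at off₁ off₂ = f-lin (m ↑ʳ i) a b
        (λ j → trans (lookupʳ T M i j) (trans (at j)
          (sym (+-cong (*-congˡ (lookupʳ T N i j)) (*-congˡ (lookupʳ T P i j))))))
        (++-cong-on (_≢ m ↑ʳ i) (λ _ _ _ → refl) (λ j j≢i → off₁ j (j≢i ∘ ≡.cong (m ↑ʳ_))))
        (++-cong-on (_≢ m ↑ʳ i) (λ _ _ _ → refl) (λ j j≢i → off₂ j (j≢i ∘ ≡.cong (m ↑ʳ_))))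

  module _ {m k} (T : Matrix Carrier m (m ℕ.+ k)) (B : Matrix Carrier k (m ℕ.+ k)) (x : Carrier) where

    det-row-opsˡ : ∀ (c : Matrix Carrier m k) →
      det ((λ i l → x · T i l + sum (λ j → c i j · B j l)) ++ B) ≈ x ^ m · det (T ++ B)
    det-row-opsˡ c = scale-and-add-rows (λ T → det (T ++ B))
      (++-congruentˡ det det-cong B) (++-rowLinearˡ det det-rowLinear B) B
      (λ T i j eq → det-alternating (T ++ B) (↑ˡ≢↑ʳ i j)
        λ l → trans (lookupˡ T B i l) (trans (eq l) (sym (lookupʳ T B j l))))
      x c T

    det-row-opsʳ : ∀ (c : Matrix Carrier k m) →
      det (T ++ (λ i l → x · B i l + sum (λ j → c i j · T j l))) ≈ x ^ k · det (T ++ B)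
    det-row-opsʳ c = scale-and-add-rows (λ B → det (T ++ B))
      (++-congruentʳ det det-cong T) (++-rowLinearʳ det det-rowLinear T) T
      (λ B i j eq → det-alternating (T ++ B) (↑ˡ≢↑ʳ j i)
        λ l → trans (lookupˡ T B j l) (trans (sym (eq l)) (sym (lookupʳ T B i l))))
      x c B

  -- Scalar matrices and block triangular determinants

  scalar : ∀ {n} → Carrier → Matrix Carrier n n
  scalar x i j = if does (i ≟ j) then x else 0#

  scalar-↑ˡ↑ˡ : ∀ {m} k x (i j : Fin m) → scalar x (i ↑ˡ k) (j ↑ˡ k) ≡ scalar x i j
  scalar-↑ˡ↑ˡ k x zero    zero    = ≡.refl
  scalar-↑ˡ↑ˡ k x zero    (suc j) = ≡.refl
  scalar-↑ˡ↑ˡ k x (suc i) zero    = ≡.refl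
  scalar-↑ˡ↑ˡ k x (suc i) (suc j) = scalar-↑ˡ↑ˡ k x i j

  scalar-↑ˡ↑ʳ : ∀ {m k} x (i : Fin m) (j : Fin k) → scalar x (i ↑ˡ k) (m ↑ʳ j) ≡ 0#
  scalar-↑ˡ↑ʳ x zero    j = ≡.refl
  scalar-↑ˡ↑ʳ x (suc i) j = scalar-↑ˡ↑ʳ x i j

  scalar-↑ʳ↑ˡ : ∀ {m k} x (i : Fin k) (j : Fin m) → scalar x (m ↑ʳ i) (j ↑ˡ k) ≡ 0#
  scalar-↑ʳ↑ˡ x i zero    = ≡.refl
  scalar-↑ʳ↑ˡ x i (suc j) = scalar-↑ʳ↑ˡ x i j

  scalar-↑ʳ↑ʳ : ∀ m {k} x (i j : Fin k) → scalar x (m ↑ʳ i) (m ↑ʳ j) ≡ scalar x i j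
  scalar-↑ʳ↑ʳ zero    x i j = ≡.refl
  scalar-↑ʳ↑ʳ (suc m) x i j = scalar-↑ʳ↑ʳ m x i j

  scalar-* : ∀ {n} x y (i j : Fin n) → x · scalar y i j ≈ scalar (x · y) i j
  scalar-* x y zero    zero    = refl
  scalar-* x y zero    (suc j) = zeroʳ x
  scalar-* x y (suc i) zero    = zeroʳ x
  scalar-* x y (suc i) (suc j) = scalar-* x y i j

  sum-scalar : ∀ {n} x (v : Vector Carrier n) k → sum (λ j → v j · scalar x j k) ≈ v k · x
  sum-scalar x v zero    = trans (+-congˡ (sum-zero (λ j → v (suc j) · 0#) λ j → zeroʳ _)) (+-identityʳ _)
  sum-scalar x v (suc k) = trans (+-cong (zeroʳ _) (sum-scalar x (v ∘ suc) k)) (+-identityˡ _)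

  det-scalar : ∀ {n} x {M : Matrix Carrier n n} → (∀ i j → M i j ≈ scalar x i j) → det M ≈ x ^ n
  det-scalar {zero}  x M≈x = refl
  det-scalar {suc n} x {M} M≈x = begin
    laplace M zero + sum (laplace M ∘ suc)
      ≈⟨ +-cong (*-cong (trans (*-identityˡ _) (M≈x zero zero)) (det-scalar x λ i j → M≈x (suc i) (suc j)))
                (sum-zero (laplace M ∘ suc) λ j → trans (*-congʳ (trans (*-congˡ (M≈x zero (suc j))) (zeroʳ _))) (zeroˡ _)) ⟩
    x · x ^ n + 0#
      ≈⟨ +-identityʳ _ ⟩
    x ^ suc n ∎

  -- In the first row only the left columns contribute, and deleting one of them leaves a matrix of
  -- the same shape. The blocks are described entrywise because a minor of a block matrix is not
  -- literally a block matrix.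
  det-lower : ∀ m {k} x (A : Matrix Carrier m m) (M : Matrix Carrier (m ℕ.+ k) (m ℕ.+ k)) →
    (∀ i j → M (i ↑ˡ k) (j ↑ˡ k) ≈ A i j) →
    (∀ i j → M (i ↑ˡ k) (m ↑ʳ j) ≈ 0#) →
    (∀ i j → M (m ↑ʳ i) (m ↑ʳ j) ≈ scalar x i j) →
    det M ≈ det A · x ^ k
  det-lower zero    x A M M≈A M≈0 M≈x = trans (det-scalar x M≈x) (sym (*-identityˡ _))
  det-lower (suc m) {k} x A M M≈A M≈0 M≈x = begin
    det M
      ≈⟨ sum-split (suc m) (laplace M) ⟩
    sum (λ j → laplace M (j ↑ˡ k)) + sum (λ j → laplace M (suc m ↑ʳ j))
      ≈⟨ +-cong (sum-cong (λ j → laplace M (j ↑ˡ k)) (λ j → x ^ k · laplace A j) left)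
                (sum-zero (λ j → laplace M (suc m ↑ʳ j)) λ j →
                   trans (*-congʳ (trans (*-congˡ (M≈0 zero j)) (zeroʳ _))) (zeroˡ _)) ⟩
    sum (λ j → x ^ k · laplace A j) + 0#
      ≈⟨ +-identityʳ _ ⟩
    sum (λ j → x ^ k · laplace A j)
      ≈⟨ *-distribˡ-sum (x ^ k) (laplace A) ⟨
    x ^ k · det A
      ≈⟨ *-comm _ _ ⟩
    det A · x ^ k ∎
    where
    minor-lower : ∀ j → det (minor M (j ↑ˡ k)) ≈ det (minor A j) · x ^ k
    minor-lower j = det-lower m x (minor A j) (minor M (j ↑ˡ k))
      (λ i l → trans (reflexive (≡.cong (M (suc i ↑ˡ k)) (punchIn-↑ˡ k j l))) (M≈A (suc i) (punchIn j l)))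
      (λ i l → trans (reflexive (≡.cong (M (suc i ↑ˡ k)) (punchIn-↑ʳ m j l))) (M≈0 (suc i) l))
      (λ i l → trans (reflexive (≡.cong (M (suc m ↑ʳ i)) (punchIn-↑ʳ m j l))) (M≈x i l))
    left : ∀ j → laplace M (j ↑ˡ k) ≈ x ^ k · laplace A j
    left j = begin
      laplace M (j ↑ˡ k)
        ≈⟨ *-cong (*-cong (reflexive (≡.cong ((- 1#) ^_) (toℕ-↑ˡ j k))) (M≈A zero j)) (minor-lower j) ⟩
      sign j · A zero j · (det (minor A j) · x ^ k)
        ≈⟨ solve 3 (λ a b c → a :* (b :* c) := c :* (a :* b)) refl (sign j · A zero j) (det (minor A j)) (x ^ k) ⟩
      x ^ k · laplace A j ∎

  det-zero-column : ∀ {n} (M : Matrix Carrier (suc n) (suc n)) → (∀ i → M i zero ≈ 0#) → det M ≈ 0#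
  det-zero-minor : ∀ {n} (M : Matrix Carrier (suc n) (suc n)) → (∀ i → M (suc i) zero ≈ 0#) →
                   ∀ j → det (minor M (suc j)) ≈ 0#
  det-zero-column M M≈0 = sum-zero (laplace M) λ
    { zero    → trans (*-congʳ (trans (*-congˡ (M≈0 zero)) (zeroʳ _))) (zeroˡ _)
    ; (suc j) → trans (*-congˡ (det-zero-minor M (M≈0 ∘ suc) j)) (zeroʳ _) }
  det-zero-minor {suc n} M M≈0 j = det-zero-column (minor M (suc j)) M≈0

  -- The first row may be nonzero to the right, so its entries do not help. Column zero vanishes
  -- below the top, hence every minor that keeps it is zero and only the first term of the expansion
  -- survives.
  det-upper : ∀ m {k} x (A : Matrix Carrier k k) (M : Matrix Carrier (m ℕ.+ k) (m ℕ.+ k)) →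
    (∀ i j → M (i ↑ˡ k) (j ↑ˡ k) ≈ scalar x i j) →
    (∀ i j → M (m ↑ʳ i) (j ↑ˡ k) ≈ 0#) →
    (∀ i j → M (m ↑ʳ i) (m ↑ʳ j) ≈ A i j) →
    det M ≈ x ^ m · det A
  det-upper zero    x A M M≈x M≈0 M≈A = trans (det-cong M≈A) (sym (*-identityˡ _))
  det-upper (suc m) {k} x A M M≈x M≈0 M≈A = begin
    laplace M zero + sum (laplace M ∘ suc)
      ≈⟨ +-cong (*-cong (trans (*-identityˡ _) (M≈x zero zero))
                        (det-upper m x A (minor M zero) (λ i j → M≈x (suc i) (suc j)) (λ i j → M≈0 i (suc j)) M≈A))
                (sum-zero (laplace M ∘ suc) λ j → trans (*-congˡ (det-zero-minor M column j)) (zeroʳ _)) ⟩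
    x · (x ^ m · det A) + 0#
      ≈⟨ trans (+-identityʳ _) (sym (*-assoc _ _ _)) ⟩
    x ^ suc m · det A ∎
    where
    column : ∀ i → M (suc i) zero ≈ 0#
    column = splitFin m (λ i → M (suc i) zero ≈ 0#) (λ i → M≈x (suc i) zero) (λ i → M≈0 i zero)

  -- The matrices G(U, V) and their two reductions

  product : ∀ {m k n} → Matrix Carrier m k → Matrix Carrier k n → Matrix Carrier m n
  product U V i j = sum λ l → U i l · V l j

  -- This is x times the Schur complement x I - U (x I)⁻¹ V, written without division.
  schur : ∀ {m k} → Carrier → Matrix Carrier m k → Matrix Carrier k m → Matrix Carrier m m
  schur x U V i j = scalar (x · x) i j + - product U V i j

  bordered : ∀ {m k} → Carrier → Matrix Carrier m k → Matrix Carrier k m → Matrix Carrier (m ℕ.+ k) (m ℕ.+ k)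
  bordered x U V = fromBlocks (scalar x) U V (scalar x)

  module _ {m k} (x : Carrier) (U : Matrix Carrier m k) (V : Matrix Carrier k m) where

    private
      top : Matrix Carrier m (m ℕ.+ k)
      top = zipWith _++_ (scalar x) U

      bottom : Matrix Carrier k (m ℕ.+ k)
      bottom = zipWith _++_ V (scalar x)

      top-l : ∀ i j → top i (j ↑ˡ k) ≈ scalar x i j
      top-l i j = reflexive (lookup-++ˡ (scalar x i) (U i) j)

      top-r : ∀ i j → top i (m ↑ʳ j) ≈ U i j
      top-r i j = reflexive (lookup-++ʳ (scalar x i) (U i) j)

      bottom-l : ∀ i j → bottom i (j ↑ˡ k) ≈ V i j
      bottom-l i j = reflexive (lookup-++ˡ (V i) (scalar x i) j)

      bottom-r : ∀ i j → bottom i (m ↑ʳ j) ≈ scalar x i j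
      bottom-r i j = reflexive (lookup-++ʳ (V i) (scalar x i) j)

      schur-entry : ∀ {n l} (P : Matrix Carrier n l) (Q : Matrix Carrier l n) {s : Carrier} {r : Vector Carrier l} i j →
        s ≈ scalar x i j → (∀ h → r h ≈ Q h j) → x · s + sum (λ h → - P i h · r h) ≈ schur x P Q i j
      schur-entry P Q {s} {r} i j s≈ r≈ = +-cong (trans (*-congˡ s≈) (scalar-* x x i j))
        (trans (sum-cong (λ h → - P i h · r h) (λ h → - (P i h · Q h j))
                 λ h → trans (*-congˡ (r≈ h)) (sym (-‿distribˡ-* _ _)))
               (sum-neg (λ h → P i h · Q h j)))

      -- Combining the rows of x I with coefficients -p gives -x p, which cancels the row p scaled
      -- by x.
      zero-entry : ∀ {l} (p : Vector Carrier l) {s : Carrier} {r : Vector Carrier l} j →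
        s ≈ p j → (∀ h → r h ≈ scalar x h j) → x · s + sum (λ h → - p h · r h) ≈ 0#
      zero-entry p {s} {r} j s≈ r≈ = begin
        x · s + sum (λ h → - p h · r h)
          ≈⟨ +-cong (*-congˡ s≈) (trans (sum-cong (λ h → - p h · r h) (λ h → - p h · scalar x h j) λ h → *-congˡ (r≈ h))
                                        (sum-scalar x (λ h → - p h) j)) ⟩
        x · p j + - p j · x      ≈⟨ +-cong (*-comm _ _) (sym (-‿distribˡ-* _ _)) ⟩
        p j · x + - (p j · x)    ≈⟨ -‿inverseʳ _ ⟩
        0#                       ∎

    -- Left multiplication by [x I, −U; 0, I] clears the top right block.
    det-borderedˡ : x ^ m · det (bordered x U V) ≈ det (schur x U V) · x ^ k
    det-borderedˡ = begin
      x ^ m · det (top ++ bottom)   ≈⟨ det-row-opsˡ top bottom x (λ i j → - U i j) ⟨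
      det (new ++ bottom)           ≈⟨ det-lower m x (schur x U V) (new ++ bottom)
        (λ i j → trans (lookupˡ new bottom i _) (schur-entry U V i j (top-l i j) λ h → bottom-l h j))
        (λ i j → trans (lookupˡ new bottom i _) (zero-entry (U i) j (top-r i j) λ h → bottom-r h j))
        (λ i j → trans (lookupʳ new bottom i _) (bottom-r i j)) ⟩
      det (schur x U V) · x ^ k     ∎
      where
      new : Matrix Carrier m (m ℕ.+ k)
      new i l = x · top i l + sum (λ j → - U i j · bottom j l)

    -- Left multiplication by [I, 0; −V, x I] clears the bottom left block.
    det-borderedʳ : x ^ k · det (bordered x U V) ≈ x ^ m · det (schur x V U)
    det-borderedʳ = begin
      x ^ k · det (top ++ bottom)   ≈⟨ det-row-opsʳ top bottom x (λ i j → - V i j) ⟨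
      det (top ++ new)              ≈⟨ det-upper m x (schur x V U) (top ++ new)
        (λ i j → trans (lookupˡ top new i _) (top-l i j))
        (λ i j → trans (lookupʳ top new i _) (zero-entry (V i) j (bottom-l i j) λ h → top-l h j))
        (λ i j → trans (lookupʳ top new i _) (schur-entry V U i j (bottom-r i j) λ h → top-r h j)) ⟩
      x ^ m · det (schur x V U)     ∎
      where
      new : Matrix Carrier k (m ℕ.+ k)
      new i l = x · bottom i l + sum (λ j → - V i j · top j l)

  -- `concat` reads its argument through `quotRem`, whose first component is the position inside a
  -- block. Identical blocks depend on nothing else, so each contributes the same sum.
  sum-quotRem : ∀ n {k} (f : Vector Carrier k) → sum {n * k} (λ t → f (proj₁ (quotRem {n} k t))) ≈ n × sum f
  sum-quotRem zero    f = refl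
  sum-quotRem (suc n) {k} f = begin
    sum {suc n * k} (λ t → f (proj₁ (quotRem {suc n} k t)))
      ≈⟨ sum-split k _ ⟩
    sum (λ i → f (proj₁ (quotRem {suc n} k (i ↑ˡ (n * k))))) + sum (λ i → f (proj₁ (quotRem {suc n} k (k ↑ʳ i))))
      ≈⟨ +-cong (sum-cong _ f λ i → reflexive (≡.cong f (remˡ i)))
                (sum-cong _ (λ t → f (proj₁ (quotRem {n} k t))) λ i → reflexive (≡.cong f (remʳ i))) ⟩
    sum f + sum {n * k} (λ t → f (proj₁ (quotRem {n} k t)))
      ≈⟨ +-congˡ (sum-quotRem n f) ⟩
    sum f + n × sum f ∎
    where
    remˡ : ∀ i → proj₁ (quotRem {suc n} k (i ↑ˡ (n * k))) ≡ i
    remˡ i rewrite splitAt-↑ˡ k i (n * k) = ≡.refl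
    remʳ : ∀ i → proj₁ (quotRem {suc n} k (k ↑ʳ i)) ≡ proj₁ (quotRem {n} k i)
    remʳ i rewrite splitAt-↑ʳ k (n * k) i = ≡.refl

  -- Block multiplication gives n X Y. The factor is attached to `X` so that the result is again a
  -- product with the inner size `k`.
  product-blocks : ∀ {m k} n (X : Matrix Carrier m k) (Y : Matrix Carrier k m) i j →
    product (rowOfBlocks n X) (columnOfBlocks n Y) i j ≈ product (λ i j → n × X i j) Y i j
  product-blocks n X Y i j = begin
    product (rowOfBlocks n X) (columnOfBlocks n Y) i j  ≈⟨ sum-quotRem n (λ l → X i l · Y l j) ⟩
    n × product X Y i j                                 ≈⟨ ×-sum n (λ l → X i l · Y l j) ⟩
    sum (λ l → n × (X i l · Y l j))                     ≈⟨ sum-cong _ (λ l → (n × X i l) · Y l j) (λ l → sym (×-assoc-* n _ _)) ⟩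
    product (λ i j → n × X i j) Y i j                   ∎
    where
    ×-sum : ∀ n {l} (f : Vector Carrier l) → n × sum f ≈ sum (λ i → n × f i)
    ×-sum zero    f = sym (sum-zero (λ i → zero × f i) λ _ → refl)
    ×-sum (suc n) f = trans (+-congˡ (×-sum n f)) (sym (∑-distrib-+ f (λ i → n × f i)))

  -- The inner sizes `k` and `l` may differ, which is what allows matrices G of different sizes to
  -- be compared.
  schur-cong : ∀ {m k l} x (U : Matrix Carrier m k) (V : Matrix Carrier k m) (U′ : Matrix Carrier m l) (V′ : Matrix Carrier l m) →
    (∀ i j → product U V i j ≈ product U′ V′ i j) → det (schur x U V) ≈ det (schur x U′ V′)
  schur-cong x U V U′ V′ eq = det-cong λ i j → +-congˡ (-‿cong (eq i j))

  -- Comparing determinants by cancelling powers of x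

  module _ (x : Carrier) (x-cancel : ∀ {y z} → x · y ≈ x · z → y ≈ z) where

    ^-cancel : ∀ n {y z} → x ^ n · y ≈ x ^ n · z → y ≈ z
    ^-cancel zero    eq = trans (sym (*-identityˡ _)) (trans eq (*-identityˡ _))
    ^-cancel (suc n) eq = ^-cancel n (x-cancel (trans (sym (*-assoc _ _ _)) (trans eq (*-assoc _ _ _))))

    -- Interchanging the sizes makes the second identity for G(U′, V′) carry the same powers of x as
    -- the first for G(U, V), so no stray factor remains.
    det-bordered-swap : ∀ {m k} (U : Matrix Carrier m k) (V : Matrix Carrier k m) (U′ : Matrix Carrier k m) (V′ : Matrix Carrier m k) →
      (∀ i j → product U V i j ≈ product V′ U′ i j) → det (bordered x U V) ≈ det (bordered x U′ V′)
    det-bordered-swap {m} {k} U V U′ V′ eq = ^-cancel m (begin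
      x ^ m · det (bordered x U V)    ≈⟨ det-borderedˡ x U V ⟩
      det (schur x U V) · x ^ k       ≈⟨ *-comm _ _ ⟩
      x ^ k · det (schur x U V)       ≈⟨ *-congˡ (schur-cong x U V V′ U′ eq) ⟩
      x ^ k · det (schur x V′ U′)     ≈⟨ det-borderedʳ x U′ V′ ⟨
      x ^ m · det (bordered x U′ V′)  ∎)

    -- Both matrices have the same product U V, while their inner sizes are k + n k and k; the
    -- factor accounts for the difference. The number of copies is `suc n`.
    det-bordered-blocks : ∀ {m k} n (X : Matrix Carrier m k) (Y : Matrix Carrier k m) →
      det (bordered x (rowOfBlocks (suc n) X) (columnOfBlocks (suc n) Y)) ≈
      x ^ (n * k) · det (bordered x (λ i j → suc n × X i j) Y)
    det-bordered-blocks {m} {k} n X Y = ^-cancel m (begin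
      x ^ m · det (bordered x (rowOfBlocks (suc n) X) (columnOfBlocks (suc n) Y))
        ≈⟨ det-borderedˡ x (rowOfBlocks (suc n) X) (columnOfBlocks (suc n) Y) ⟩
      det (schur x (rowOfBlocks (suc n) X) (columnOfBlocks (suc n) Y)) · x ^ (k ℕ.+ n * k)
        ≈⟨ *-cong (schur-cong x (rowOfBlocks (suc n) X) (columnOfBlocks (suc n) Y) nX Y (product-blocks (suc n) X Y)) (^-homo-* x k (n * k)) ⟩
      det (schur x nX Y) · (x ^ k · x ^ (n * k))
        ≈⟨ *-assoc _ _ _ ⟨
      det (schur x nX Y) · x ^ k · x ^ (n * k)
        ≈⟨ *-congʳ (sym (det-borderedˡ x nX Y)) ⟩
      x ^ m · det (bordered x nX Y) · x ^ (n * k)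
        ≈⟨ solve 3 (λ a b c → a :* b :* c := a :* (c :* b)) refl (x ^ m) (det (bordered x nX Y)) (x ^ (n * k)) ⟩
      x ^ m · (x ^ (n * k) · det (bordered x nX Y)) ∎)
      where
      nX : Matrix Carrier m k
      nX i j = suc n × X i j

    det-bordered-transpose : ∀ {p q} n → p ≥ q → (B : Matrix Carrier p q) →
      det (bordered x (rowOfBlocks (suc n) (transpose B)) (columnOfBlocks (suc n) B)) ≈
      det (bordered x (rowOfBlocks (suc n) B) (columnOfBlocks (suc n) (transpose B))) · x ^ (n * (p ∸ q))
    det-bordered-transpose {p} {q} n p≥q B = begin
      det (bordered x (rowOfBlocks (suc n) (transpose B)) (columnOfBlocks (suc n) B))
        ≈⟨ det-bordered-blocks n (transpose B) B ⟩
      x ^ (n * p) · E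
        -- Since p ≥ q, `p ∸ q` is a true difference and n p = n q + n (p - q).
        ≈⟨ *-congʳ (trans (^-congʳ x exponent) (^-homo-* x (n * q) (n * (p ∸ q)))) ⟩
      x ^ (n * q) · x ^ (n * (p ∸ q)) · E
        ≈⟨ solve 3 (λ a b e → a :* b :* e := a :* e :* b) refl (x ^ (n * q)) (x ^ (n * (p ∸ q))) E ⟩
      x ^ (n * q) · E · x ^ (n * (p ∸ q))
        -- The required equality is (n+1)B · Bᵀ = B · ((n+1)B)ᵀ: the integer factor passes across
        -- each product of entries.
        ≈⟨ *-congʳ (*-congˡ (det-bordered-swap nB (transpose B) (transpose nB) B λ i j →
             sum-cong (λ l → nB i l · B j l) (λ l → B i l · nB j l) λ l →
               trans (×-assoc-* (suc n) (B i l) (B j l)) (sym (×-comm-* (suc n) (B i l) (B j l))))) ⟨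
      x ^ (n * q) · det (bordered x nB (transpose B)) · x ^ (n * (p ∸ q))
        ≈⟨ *-congʳ (det-bordered-blocks n B (transpose B)) ⟨
      det (bordered x (rowOfBlocks (suc n) B) (columnOfBlocks (suc n) (transpose B))) · x ^ (n * (p ∸ q)) ∎
      where
      nB : Matrix Carrier p q
      nB i j = suc n × B i j
      E : Carrier
      E = det (bordered x (transpose nB) B)
      exponent : n * p ≡ n * q ℕ.+ n * (p ∸ q)
      exponent = ≡.trans (≡.cong (n *_) (≡.sym (ℕ.m+[n∸m]≡n p≥q))) (ℕ.*-distribˡ-+ n q (p ∸ q))

  -- For polynomials over R, ν is y ↦ − constant y, so that charMatrix M is x I − M.
  module _ {a} {A : Set a} (ν : A → Carrier) (z : A) (νz≈0 : ν z ≈ 0#) (x : Carrier) where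

    charMatrix : ∀ {n} → Matrix A n n → Matrix Carrier n n
    charMatrix M i j = scalar x i j + ν (M i j)

    zeros : ∀ {m n} → Matrix A m n
    zeros _ _ = z

    apply : ∀ {m n} → Matrix A m n → Matrix Carrier m n
    apply M i j = ν (M i j)

    private
      diagonal : ∀ {s t y} → s ≡ t → y ≡ z → s + ν y ≈ t
      diagonal ≡.refl ≡.refl = trans (+-congˡ νz≈0) (+-identityʳ _)

      off-diagonal : ∀ {s y y′} → s ≡ 0# → y ≡ y′ → s + ν y ≈ ν y′
      off-diagonal ≡.refl ≡.refl = +-identityˡ _

    det-charMatrix-bipartite : ∀ {m k} (U : Matrix A m k) (V : Matrix A k m) →
      det (charMatrix (fromBlocks zeros U V zeros)) ≈ det (bordered x (apply U) (apply V))
    det-charMatrix-bipartite {m} {k} U V = det-cong (splitFin m (λ i → ∀ j → Entry i j)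
      (λ i → splitFin m (Entry (i ↑ˡ k))
        (λ j → trans (diagonal (scalar-↑ˡ↑ˡ k x i j) (fromBlocks-↑ˡ↑ˡ zeros U V zeros i j))
                     (reflexive (≡.sym (fromBlocks-↑ˡ↑ˡ (scalar x) (apply U) (apply V) (scalar x) i j))))
        (λ j → trans (off-diagonal (scalar-↑ˡ↑ʳ x i j) (fromBlocks-↑ˡ↑ʳ zeros U V zeros i j))
                     (reflexive (≡.sym (fromBlocks-↑ˡ↑ʳ (scalar x) (apply U) (apply V) (scalar x) i j)))))
      (λ i → splitFin m (Entry (m ↑ʳ i))
        (λ j → trans (off-diagonal (scalar-↑ʳ↑ˡ x i j) (fromBlocks-↑ʳ↑ˡ zeros U V zeros i j))
                     (reflexive (≡.sym (fromBlocks-↑ʳ↑ˡ (scalar x) (apply U) (apply V) (scalar x) i j))))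
        (λ j → trans (diagonal (scalar-↑ʳ↑ʳ m x i j) (fromBlocks-↑ʳ↑ʳ zeros U V zeros i j))
                     (reflexive (≡.sym (fromBlocks-↑ʳ↑ʳ (scalar x) (apply U) (apply V) (scalar x) i j))))))
      where
      Entry : Fin (m ℕ.+ k) → Fin (m ℕ.+ k) → Set ℓ
      Entry i j = charMatrix (fromBlocks zeros U V zeros) i j ≈ bordered x (apply U) (apply V) i j

    det-charMatrix-⊕-zeros : ∀ {m} r (M : Matrix A m m) →
      det (charMatrix (fromBlocks M (zeros {m} {r}) zeros zeros)) ≈ det (charMatrix M) · x ^ r
    det-charMatrix-⊕-zeros {m} r M = det-lower m x (charMatrix M) (charMatrix (fromBlocks M zeros zeros zeros))
      (λ i j → reflexive (≡.cong₂ (λ s y → s + ν y) (scalar-↑ˡ↑ˡ r x i j) (fromBlocks-↑ˡ↑ˡ M zeros zeros zeros i j)))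
      (λ i j → diagonal (scalar-↑ˡ↑ʳ x i j) (fromBlocks-↑ˡ↑ʳ M zeros zeros zeros i j))
      (λ i j → diagonal (scalar-↑ʳ↑ʳ m x i j) (fromBlocks-↑ʳ↑ʳ M zeros zeros zeros i j))

    charMatrix-cospectral : (∀ {y z} → x · y ≈ x · z → y ≈ z) → ∀ {p q} n → p ≥ q → (B : Matrix A p q) →
      det (charMatrix (fromBlocks zeros (rowOfBlocks (suc n) (transpose B)) (columnOfBlocks (suc n) B) zeros)) ≈
      det (charMatrix (fromBlocks (fromBlocks zeros (rowOfBlocks (suc n) B) (columnOfBlocks (suc n) (transpose B)) zeros)
                                  (zeros {n = n * (p ∸ q)}) zeros zeros))
    charMatrix-cospectral x-cancel {p} {q} n p≥q B = begin
      det (charMatrix (fromBlocks zeros (rowOfBlocks (suc n) (transpose B)) (columnOfBlocks (suc n) B) zeros))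
        ≈⟨ det-charMatrix-bipartite (rowOfBlocks (suc n) (transpose B)) (columnOfBlocks (suc n) B) ⟩
      -- Repeating blocks only re-indexes entries, so `apply` passes through it definitionally.
      det (bordered x (rowOfBlocks (suc n) (transpose (apply B))) (columnOfBlocks (suc n) (apply B)))
        ≈⟨ det-bordered-transpose x x-cancel n p≥q (apply B) ⟩
      det (bordered x (rowOfBlocks (suc n) (apply B)) (columnOfBlocks (suc n) (transpose (apply B)))) · x ^ r
        ≈⟨ *-congʳ (det-charMatrix-bipartite (rowOfBlocks (suc n) B) (columnOfBlocks (suc n) (transpose B))) ⟨
      det (charMatrix M) · x ^ r
        ≈⟨ det-charMatrix-⊕-zeros r M ⟨
      det (charMatrix (fromBlocks M zeros zeros zeros)) ∎
      where
      r = n * (p ∸ q)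
      M : Matrix A (p ℕ.+ suc n * q) (p ℕ.+ suc n * q)
      M = fromBlocks zeros (rowOfBlocks (suc n) B) (columnOfBlocks (suc n) (transpose B)) zeros

-- The polynomial ring on coefficient lists

module PolynomialProperties {c ℓ} (R : CommutativeRing c ℓ) where
  open CommutativeRing R hiding (zero; _-_) renaming (_*_ to infixl 7 _·_)
  open Polynomial rawRing
  open import Algebra.Properties.Ring ring using (-0#≈0#)
  open import Algebra.Solver.Ring.NaturalCoefficients.Default commutativeSemiring using (solve; _:=_; _:+_; _:*_)
  open import Relation.Binary.Reasoning.Setoid setoid

  -- The Cauchy product of sequences. Polynomials are compared coefficientwise, so the laws of
  -- multiplication are proved here, where list lengths and trailing zeros do not intervene, and
  -- transferred by `coeff-*`.
  convolution : (ℕ → Carrier) → (ℕ → Carrier) → ℕ → Carrier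
  convolution a b zero    = a zero · b zero
  convolution a b (suc i) = a zero · b (suc i) + convolution (a ∘ suc) b i

  convolution-cong : ∀ {a a′ b b′} → (∀ i → a i ≈ a′ i) → (∀ i → b i ≈ b′ i) →
                     ∀ i → convolution a b i ≈ convolution a′ b′ i
  convolution-cong a≈ b≈ zero    = *-cong (a≈ zero) (b≈ zero)
  convolution-cong a≈ b≈ (suc i) = +-cong (*-cong (a≈ zero) (b≈ (suc i))) (convolution-cong (a≈ ∘ suc) b≈ i)

  convolution-zeroˡ : ∀ b i → convolution (λ _ → 0#) b i ≈ 0#
  convolution-zeroˡ b zero    = zeroˡ _
  convolution-zeroˡ b (suc i) = trans (+-cong (zeroˡ _) (convolution-zeroˡ b i)) (+-identityˡ 0#)

  -- A convolution shifted by one place is a multiple of a sequence plus a convolution, the form met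
  -- in `convolution-assoc`. With x = 1 this is distributivity.
  convolution-linearˡ : ∀ x a a′ b i →
    convolution (λ j → x · a j + a′ j) b i ≈ x · convolution a b i + convolution a′ b i
  convolution-linearˡ x a a′ b zero = solve 4 (λ x a a′ b → (x :* a :+ a′) :* b := x :* (a :* b) :+ a′ :* b)
    refl x (a zero) (a′ zero) (b zero)
  convolution-linearˡ x a a′ b (suc i) = trans (+-congˡ (convolution-linearˡ x (a ∘ suc) (a′ ∘ suc) b i))
    (solve 6 (λ x a a′ b u v → (x :* a :+ a′) :* b :+ (x :* u :+ v) := x :* (a :* b :+ u) :+ (a′ :* b :+ v))
      refl x (a zero) (a′ zero) (b (suc i)) (convolution (a ∘ suc) b i) (convolution (a′ ∘ suc) b i))

  -- The definition splits off the term with `a zero`; commutativity also needs the opposite end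
  -- split off.
  convolution-suc : ∀ a b i → convolution a b (suc i) ≈ convolution a (b ∘ suc) i + a (suc i) · b zero
  convolution-suc a b zero    = refl
  convolution-suc a b (suc i) = trans (+-congˡ (convolution-suc (a ∘ suc) b i)) (sym (+-assoc _ _ _))

  convolution-comm : ∀ a b i → convolution a b i ≈ convolution b a i
  convolution-comm a b zero    = *-comm _ _
  convolution-comm a b (suc i) = begin
    a zero · b (suc i) + convolution (a ∘ suc) b i   ≈⟨ +-cong (*-comm _ _) (convolution-comm (a ∘ suc) b i) ⟩
    b (suc i) · a zero + convolution b (a ∘ suc) i   ≈⟨ +-comm _ _ ⟩
    convolution b (a ∘ suc) i + b (suc i) · a zero   ≈⟨ convolution-suc b a i ⟨
    convolution b a (suc i)                          ∎

  convolution-assoc : ∀ a b d i → convolution (convolution a b) d i ≈ convolution a (convolution b d) i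
  convolution-assoc a b d zero    = *-assoc _ _ _
  convolution-assoc a b d (suc i) = begin
    a₀ · b zero · d (suc i) + convolution (λ j → a₀ · b (suc j) + convolution (a ∘ suc) b j) d i
      ≈⟨ +-congˡ (convolution-linearˡ a₀ (b ∘ suc) (convolution (a ∘ suc) b) d i) ⟩
    a₀ · b zero · d (suc i) + (a₀ · convolution (b ∘ suc) d i + convolution (convolution (a ∘ suc) b) d i)
      ≈⟨ +-congˡ (+-congˡ (convolution-assoc (a ∘ suc) b d i)) ⟩
    a₀ · b zero · d (suc i) + (a₀ · convolution (b ∘ suc) d i + convolution (a ∘ suc) (convolution b d) i)
      ≈⟨ solve 5 (λ a b d u v → a :* b :* d :+ (a :* u :+ v) := a :* (b :* d :+ u) :+ v) refl
           a₀ (b zero) (d (suc i)) (convolution (b ∘ suc) d i) (convolution (a ∘ suc) (convolution b d) i) ⟩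
    convolution a (convolution b d) (suc i) ∎
    where
    a₀ = a zero

  coeff-+ : ∀ f g i → coeff (f +ₚ g) i ≈ coeff f i + coeff g i
  coeff-+ []      g       i       = sym (+-identityˡ _)
  coeff-+ (x ∷ f) []      i       = sym (+-identityʳ _)
  coeff-+ (x ∷ f) (y ∷ g) zero    = refl
  coeff-+ (x ∷ f) (y ∷ g) (suc i) = coeff-+ f g i

  coeff-neg : ∀ f i → coeff (List.map -_ f) i ≈ - coeff f i
  coeff-neg []      i       = sym -0#≈0#
  coeff-neg (x ∷ f) zero    = refl
  coeff-neg (x ∷ f) (suc i) = coeff-neg f i

  coeff-scale : ∀ x f i → coeff (List.map (x ·_) f) i ≈ x · coeff f i
  coeff-scale x []      i       = sym (zeroʳ x)
  coeff-scale x (y ∷ f) zero    = refl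
  coeff-scale x (y ∷ f) (suc i) = coeff-scale x f i

  coeff-* : ∀ f g i → coeff (f *ₚ g) i ≈ convolution (coeff f) (coeff g) i
  coeff-* []      g i       = sym (convolution-zeroˡ (coeff g) i)
  coeff-* (x ∷ f) g zero    = trans (coeff-+ (List.map (x ·_) g) (0# ∷ f *ₚ g) zero)
    (trans (+-identityʳ _) (coeff-scale x g zero))
  coeff-* (x ∷ f) g (suc i) = trans (coeff-+ (List.map (x ·_) g) (0# ∷ f *ₚ g) (suc i))
    (+-cong (coeff-scale x g (suc i)) (coeff-* f g i))

  convolution-constant : ∀ x b i → convolution (coeff (constant x)) b i ≈ x · b i
  convolution-constant x b zero    = refl
  convolution-constant x b (suc i) = trans (+-congˡ (convolution-zeroˡ b i)) (+-identityʳ _)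

  coeff-indeterminate-* : ∀ f i → coeff (indeterminate *ₚ f) (suc i) ≈ coeff f i
  coeff-indeterminate-* f i = begin
    coeff (indeterminate *ₚ f) (suc i)                             ≈⟨ coeff-* indeterminate f (suc i) ⟩
    0# · coeff f (suc i) + convolution (coeff (constant 1#)) (coeff f) i  ≈⟨ +-cong (zeroˡ _) (convolution-constant 1# (coeff f) i) ⟩
    0# + 1# · coeff f i                                            ≈⟨ trans (+-identityˡ _) (*-identityˡ _) ⟩
    coeff f i                                                      ∎

  -- Multiplication by x shifts the coefficients by one place, so cancellation holds whatever zero
  -- divisors `R` has.
  indeterminate-cancel : ∀ {f g} → indeterminate *ₚ f ≈ₚ indeterminate *ₚ g → f ≈ₚ g
  indeterminate-cancel {f} {g} eq i =
    trans (sym (coeff-indeterminate-* f i)) (trans (eq (suc i)) (coeff-indeterminate-* g i))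

  -- The left side is a list of one entry, hence zero only coefficientwise.
  neg-constant-0# : List.map -_ (constant 0#) ≈ₚ []
  neg-constant-0# zero    = -0#≈0#
  neg-constant-0# (suc i) = refl

  *ₚ-comm : ∀ f g → f *ₚ g ≈ₚ g *ₚ f
  *ₚ-comm f g i = trans (coeff-* f g i) (trans (convolution-comm (coeff f) (coeff g) i) (sym (coeff-* g f i)))

  *ₚ-identityˡ : ∀ f → constant 1# *ₚ f ≈ₚ f
  *ₚ-identityˡ f i = trans (coeff-* (constant 1#) f i) (trans (convolution-constant 1# (coeff f) i) (*-identityˡ _))

  *ₚ-assoc : ∀ f g h → (f *ₚ g) *ₚ h ≈ₚ f *ₚ (g *ₚ h)
  *ₚ-assoc f g h i = begin
    coeff ((f *ₚ g) *ₚ h) i                                    ≈⟨ coeff-* (f *ₚ g) h i ⟩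
    convolution (coeff (f *ₚ g)) (coeff h) i                   ≈⟨ convolution-cong (coeff-* f g) (λ _ → refl) i ⟩
    convolution (convolution (coeff f) (coeff g)) (coeff h) i  ≈⟨ convolution-assoc (coeff f) (coeff g) (coeff h) i ⟩
    convolution (coeff f) (convolution (coeff g) (coeff h)) i  ≈⟨ convolution-cong (λ _ → refl) (λ j → sym (coeff-* g h j)) i ⟩
    convolution (coeff f) (coeff (g *ₚ h)) i                   ≈⟨ coeff-* f (g *ₚ h) i ⟨
    coeff (f *ₚ (g *ₚ h)) i                                    ∎

  *ₚ-distribʳ-+ₚ : ∀ f g h → (g +ₚ h) *ₚ f ≈ₚ g *ₚ f +ₚ h *ₚ f
  *ₚ-distribʳ-+ₚ f g h i = begin
    coeff ((g +ₚ h) *ₚ f) i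
      ≈⟨ coeff-* (g +ₚ h) f i ⟩
    convolution (coeff (g +ₚ h)) (coeff f) i
      ≈⟨ convolution-cong (λ j → trans (coeff-+ g h j) (+-congʳ (sym (*-identityˡ _)))) (λ _ → refl) i ⟩
    convolution (λ j → 1# · coeff g j + coeff h j) (coeff f) i
      ≈⟨ convolution-linearˡ 1# (coeff g) (coeff h) (coeff f) i ⟩
    1# · convolution (coeff g) (coeff f) i + convolution (coeff h) (coeff f) i
      ≈⟨ +-cong (trans (*-identityˡ _) (sym (coeff-* g f i))) (sym (coeff-* h f i)) ⟩
    coeff (g *ₚ f) i + coeff (h *ₚ f) i
      ≈⟨ coeff-+ (g *ₚ f) (h *ₚ f) i ⟨
    coeff (g *ₚ f +ₚ h *ₚ f) i ∎

  +ₚ-comm : ∀ f g → f +ₚ g ≈ₚ g +ₚ f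
  +ₚ-comm f g i = trans (coeff-+ f g i) (trans (+-comm _ _) (sym (coeff-+ g f i)))

  +ₚ-assoc : ∀ f g h → (f +ₚ g) +ₚ h ≈ₚ f +ₚ (g +ₚ h)
  +ₚ-assoc f g h i = begin
    coeff ((f +ₚ g) +ₚ h) i                ≈⟨ trans (coeff-+ (f +ₚ g) h i) (+-congʳ (coeff-+ f g i)) ⟩
    coeff f i + coeff g i + coeff h i      ≈⟨ +-assoc _ _ _ ⟩
    coeff f i + (coeff g i + coeff h i)    ≈⟨ trans (coeff-+ f (g +ₚ h) i) (+-congˡ (coeff-+ g h i)) ⟨
    coeff (f +ₚ (g +ₚ h)) i                ∎

  -ₚ-inverseˡ : ∀ f → List.map -_ f +ₚ f ≈ₚ []
  -ₚ-inverseˡ f i = trans (coeff-+ (List.map -_ f) f i) (trans (+-congʳ (coeff-neg f i)) (-‿inverseˡ _))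

  polynomialRing : CommutativeRing c ℓ
  polynomialRing = record
    { Carrier           = Poly
    ; _≈_               = _≈ₚ_
    ; _+_               = _+ₚ_
    ; _*_               = _*ₚ_
    ; -_                = List.map -_
    ; 0#                = []
    ; 1#                = constant 1#
    ; isCommutativeRing = record
      { isRing = record
        { +-isAbelianGroup = record
          { isGroup = record
            { isMonoid = record
              { isSemigroup = record
                { isMagma = record
                  { isEquivalence = record
                    { refl  = λ _ → refl
                    ; sym   = λ f≈g i → sym (f≈g i)
                    ; trans = λ f≈g g≈h i → trans (f≈g i) (g≈h i)
                    }
                  ; ∙-cong = λ {f} {f′} {g} {g′} f≈ g≈ i →
                      trans (coeff-+ f g i) (trans (+-cong (f≈ i) (g≈ i)) (sym (coeff-+ f′ g′ i)))
                  }
                ; assoc = +ₚ-assoc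
                }
              ; identity = (λ f i → refl) , λ f i → +ₚ-comm f [] i
              }
            ; inverse = -ₚ-inverseˡ , λ f i → trans (+ₚ-comm f (List.map -_ f) i) (-ₚ-inverseˡ f i)
            ; ⁻¹-cong = λ {f} {g} f≈g i →
                trans (coeff-neg f i) (trans (-‿cong (f≈g i)) (sym (coeff-neg g i)))
            }
          ; comm = +ₚ-comm
          }
        ; *-cong = λ {f} {f′} {g} {g′} f≈ g≈ i →
            trans (coeff-* f g i) (trans (convolution-cong f≈ g≈ i) (sym (coeff-* f′ g′ i)))
        ; *-assoc = *ₚ-assoc
        ; *-identity = *ₚ-identityˡ , λ f i → trans (*ₚ-comm f (constant 1#) i) (*ₚ-identityˡ f i)
        ; distrib = (λ f g h i → trans (*ₚ-comm f (g +ₚ h) i) (trans (*ₚ-distribʳ-+ₚ f g h i) (swap+ f g h i)))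
                  , *ₚ-distribʳ-+ₚ
        }
      ; *-comm = *ₚ-comm
      }
    }
    where
    swap+ : ∀ f g h → g *ₚ f +ₚ h *ₚ f ≈ₚ f *ₚ g +ₚ f *ₚ h
    swap+ f g h i = begin
      coeff (g *ₚ f +ₚ h *ₚ f) i           ≈⟨ coeff-+ (g *ₚ f) (h *ₚ f) i ⟩
      coeff (g *ₚ f) i + coeff (h *ₚ f) i  ≈⟨ +-cong (*ₚ-comm g f i) (*ₚ-comm h f i) ⟩
      coeff (f *ₚ g) i + coeff (f *ₚ h) i  ≈⟨ coeff-+ (f *ₚ g) (f *ₚ h) i ⟨
      coeff (f *ₚ g +ₚ f *ₚ h) i           ∎

theorem3p2 : ∀ {c ℓ} (R : CommutativeRing c ℓ) (p q n : ℕ) → p ≥ 1 → q ≥ 1 → p ≥ q → n ≥ 1 →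
    (B : Matrix (CommutativeRing.Carrier R) p q) →
    Cospectral R (matrixD R n B) (directSum R (matrixC R n B) (zeroMatrix R ((n ∸ 1) * (p ∸ q)) ((n ∸ 1) * (p ∸ q))))
theorem3p2 R p q (suc n) _ _ p≥q _ B = 
  -- With these arguments `charMatrix` is definitionally the matrix in `charPoly`. The number of
  -- blocks is `suc n`, so `n` here is the n - 1 of the zero block.
  charMatrix-cospectral (λ y → List.map -_ (constant y)) 0# neg-constant-0# indeterminate
    (λ {f} {g} → indeterminate-cancel {f} {g}) n p≥q B
  where
  open CommutativeRing R using (-_; 0#; rawRing)
  open Polynomial rawRing using (constant; indeterminate)
  open PolynomialProperties R using (polynomialRing; neg-constant-0#; indeterminate-cancel)
  open DeterminantProperties polynomialRing using (charMatrix-cospectral)
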